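{- Any $\varepsilon$-edge-differentially private algorithm to compute the weight of a maximum weight matching in an incremental graph sequence of length $T$ must have additive error $\Omega(W\log T)$ when the edge weights are in $\{1,\dots,W\}$ and $W$ is a publicly known parameter. This holds even with $\varepsilon=1$.
   Context: Graphs are undirected and edge-weighted. An incremental graph sequence $(G_1,\dots,G_T)$ arises from an initial (possibly non-empty) graph $G_0$ by inserting at each time $t$ a set $\partial V_t^+$ of nodes and a set $\partial E_t^+$ of edges (no deletions). Two incremental sequences are edge-adjacent (event-level) if they have the same length, initial graph and node insertions, and (up to exchanging them) there are an edge $e^*$ and a time $t^*$ with $\partial E_t^+=\partial E_t'^+$ for $t\ne t^*$, $\partial E_{t^*}'^+\subseteq\partial E_{t^*}^+$ and $\partial E_{t^*}^+\setminus\partial E_{t^*}'^+=\{e^*\}$. The algorithm is randomized and outputs a real number after each time step, an estimate of the value for the current graph. It is $\varepsilon$-edge-differentially private if $\Pr[\mathcal A(\mathcal G)\in S]\le e^\varepsilon\Pr[\mathcal A(\mathcal G')\in S]$ for all edge-adjacent $\mathcal G,\mathcal G'$ and all sets $S$ of possible output sequences. The additive error at a time step is the absolute difference between the output and the true value. -}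

module Defs where

open import Level using (Level; 0ℓ; Setω)
open import Algebra.Bundles using (CommutativeRing)
import Algebra.Definitions.RawMonoid as RawMonoidDefinitions
open import Axiom.ExcludedMiddle using (ExcludedMiddle)
open import Data.Fin.Base as Fin using (Fin; inject₁)
open import Data.List.Base using (List; map; sum)
open import Data.List.Membership.Propositional using (_∈_)
open import Data.List.Relation.Unary.All using (All)
open import Data.List.Relation.Unary.AllPairs using (AllPairs)
open import Data.Nat.Base as ℕ using (ℕ; zero; suc)
open import Data.Product.Base using (Σ; ∃; _×_; _,_)
open import Data.Sum.Base using (_⊎_; [_,_]′)
open import Function.Base using (const)
open import Relation.Binary.Core using (Rel; _Preserves_⟶_)
open import Relation.Binary.PropositionalEquality.Core using (_≡_; _≢_)
open import Relation.Binary.Structures using (IsTotalOrder)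
open import Relation.Nullary.Negation.Core using (¬_)
open import Relation.Unary using (Pred; U; ∁; ⋃; _≐_; _⊆_; _∖_; _⊥_; ｛_｝)

Classical : Setω
Classical = ∀ {ℓ : Level} → ExcludedMiddle ℓ

------------------------------------------------------------------------
-- Real numbers

-- Classically, a Dedekind-complete ordered field is ℝ up to unique
-- isomorphism.  The value of 0# ⁻¹ is left unspecified.

record CompleteOrderedField : Set₁ where
  field
    commutativeRing : CommutativeRing 0ℓ 0ℓ

  open CommutativeRing commutativeRing public
    renaming (Carrier to ℝ)

  infix  4 _≤_ _<_
  infix  8 _⁻¹

  field
    _≤_           : Rel ℝ 0ℓ
    isTotalOrder  : IsTotalOrder _≈_ _≤_
    +-monoˡ-≤     : ∀ {x y} z → x ≤ y → x + z ≤ y + z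
    *-nonNegative : ∀ {x y} → 0# ≤ x → 0# ≤ y → 0# ≤ x * y
    0≉1           : ¬ 0# ≈ 1#
    _⁻¹           : ℝ → ℝ
    ⁻¹-cong       : _⁻¹ Preserves _≈_ ⟶ _≈_
    *-inverseʳ    : ∀ {x} → ¬ x ≈ 0# → x * x ⁻¹ ≈ 1#

    complete      : (S : Pred ℝ 0ℓ) → ∃ S → (∃ λ b → ∀ x → S x → x ≤ b) →
                    Σ ℝ λ s → (∀ x → S x → x ≤ s) ×
                              (∀ b → (∀ x → S x → x ≤ b) → s ≤ b)

  _<_ : Rel ℝ 0ℓ
  x < y = x ≤ y × ¬ x ≈ y

  ∣_∣ : ℝ → ℝ
  ∣ x ∣ = [ const x , const (- x) ]′ (IsTotalOrder.total isTotalOrder 0# x)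

  fromℕ : ℕ → ℝ
  fromℕ n = RawMonoidDefinitions._×_ +-rawMonoid n 1#

  partialSum : (ℕ → ℝ) → (ℕ → ℝ)
  partialSum a zero    = 0#
  partialSum a (suc n) = partialSum a n + a n

  infix 4 _⟶_

  _⟶_ : (ℕ → ℝ) → ℝ → Set
  a ⟶ l = ∀ δ → 0# < δ → Σ ℕ λ N → ∀ n → N ℕ.≤ n → ∣ a n - l ∣ ≤ δ

  -- x ^ n / n !
  expTerm : ℝ → (ℕ → ℝ)
  expTerm x zero    = 1#
  expTerm x (suc n) = expTerm x n * (x * fromℕ (suc n) ⁻¹)

-- ℝ with its exponential function, given as the sum of its power series.

record RealNumbers : Set₁ where
  field
    completeOrderedField : CompleteOrderedField

  open CompleteOrderedField completeOrderedField public

  field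
    exp        : ℝ → ℝ
    exp-series : ∀ x → partialSum (expTerm x) ⟶ exp x

------------------------------------------------------------------------
-- Weighted graphs and matchings

-- An undirected edge {lo , hi}, stored with its smaller endpoint first.
-- The proofs are irrelevant, so equal data means equal edges.

record Edge (W : ℕ) : Set where
  constructor edge
  field
    lo hi     : ℕ
    weight    : ℕ
    .lo<hi    : lo ℕ.< hi
    .1≤weight : 1 ℕ.≤ weight
    .weight≤W : weight ℕ.≤ W

-- The lists stand for finite sets: only membership in them matters.

record Graph (W : ℕ) : Set where
  field
    nodes     : List ℕ
    edges     : List (Edge W)
    endpoints : ∀ {e} → e ∈ edges → Edge.lo e ∈ nodes × Edge.hi e ∈ nodes
    simple    : ∀ {e f} → e ∈ edges → f ∈ edges →
                Edge.lo e ≡ Edge.lo f → Edge.hi e ≡ Edge.hi f → e ≡ f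

  V : Pred ℕ 0ℓ
  V x = x ∈ nodes

  E : Pred (Edge W) 0ℓ
  E e = e ∈ edges

open Graph using (V; E)

module _ {W : ℕ} where

  infix 4 _≋_

  _≋_ : Rel (Graph W) 0ℓ
  G ≋ H = V G ≐ V H × E G ≐ E H

  VertexDisjoint : Rel (Edge W) 0ℓ
  VertexDisjoint e f = lo e ≢ lo f × lo e ≢ hi f × hi e ≢ lo f × hi e ≢ hi f
    where open Edge

  -- Vertex-disjointness of all pairs also rules out repetitions in the list.
  IsMatching : Graph W → Pred (List (Edge W)) 0ℓ
  IsMatching G M = All (E G) M × AllPairs VertexDisjoint M

  matchingWeight : List (Edge W) → ℕ
  matchingWeight M = sum (map Edge.weight M)

  IsMaximumMatchingWeight : Graph W → Pred ℕ 0ℓ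
  IsMaximumMatchingWeight G m =
    (Σ (List (Edge W)) λ M → IsMatching G M × matchingWeight M ≡ m) ×
    (∀ M → IsMatching G M → matchingWeight M ℕ.≤ m)

------------------------------------------------------------------------
-- Incremental graph sequences

-- For t : Fin T, the time step t takes G (inject₁ t) to G (suc t); in
-- particular G zero is the initial graph.

record IncrementalSequence (W T : ℕ) : Set where
  field
    G      : Fin (suc T) → Graph W
    V-grow : ∀ (t : Fin T) → V (G (inject₁ t)) ⊆ V (G (Fin.suc t))
    E-grow : ∀ (t : Fin T) → E (G (inject₁ t)) ⊆ E (G (Fin.suc t))

  ∂V⁺ : Fin T → Pred ℕ 0ℓ
  ∂V⁺ t = V (G (Fin.suc t)) ∖ V (G (inject₁ t))

  ∂E⁺ : Fin T → Pred (Edge W) 0ℓ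
  ∂E⁺ t = E (G (Fin.suc t)) ∖ E (G (inject₁ t))

open IncrementalSequence using (G; ∂V⁺; ∂E⁺)

module _ {W T : ℕ} where

  record LacksOneEdge (𝒢 𝒢′ : IncrementalSequence W T) : Set where
    field
      same-initial : G 𝒢 Fin.zero ≋ G 𝒢′ Fin.zero
      same-∂V⁺     : ∀ t → ∂V⁺ 𝒢 t ≐ ∂V⁺ 𝒢′ t
      e*           : Edge W
      t*           : Fin T
      same-∂E⁺     : ∀ t → t ≢ t* → ∂E⁺ 𝒢 t ≐ ∂E⁺ 𝒢′ t
      ∂E⁺-⊆        : ∂E⁺ 𝒢′ t* ⊆ ∂E⁺ 𝒢 t*
      ∂E⁺-∖        : (∂E⁺ 𝒢 t* ∖ ∂E⁺ 𝒢′ t*) ≐ ｛ e* ｝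

  EdgeAdjacent : Rel (IncrementalSequence W T) 0ℓ
  EdgeAdjacent 𝒢 𝒢′ = LacksOneEdge 𝒢 𝒢′ ⊎ LacksOneEdge 𝒢′ 𝒢

  SameUpTo : Fin T → Rel (IncrementalSequence W T) 0ℓ
  SameUpTo t 𝒢 𝒢′ = ∀ s → s Fin.≤ Fin.suc t → G 𝒢 s ≋ G 𝒢′ s

------------------------------------------------------------------------
-- Randomised algorithms and differential privacy

module Privacy (R : RealNumbers) where
  open RealNumbers R

  -- Pr is total for convenience; it is only constrained on events.

  record ProbabilitySpace : Set₂ where
    field
      Ω           : Set
      IsEvent     : Pred Ω 0ℓ → Set₁
      event-resp  : ∀ {A B} → A ≐ B → IsEvent A → IsEvent B
      event-U     : IsEvent U
      event-∁     : ∀ {A} → IsEvent A → IsEvent (∁ A)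
      event-⋃     : (A : ℕ → Pred Ω 0ℓ) → (∀ n → IsEvent (A n)) →
                    IsEvent (⋃ ℕ A)
      Pr          : Pred Ω 0ℓ → ℝ
      Pr-cong     : ∀ {A B} → IsEvent A → A ≐ B → Pr A ≈ Pr B
      Pr-nonNeg   : ∀ {A} → IsEvent A → 0# ≤ Pr A
      Pr-U        : Pr U ≈ 1#
      σ-additive  : (A : ℕ → Pred Ω 0ℓ) → (∀ n → IsEvent (A n)) →
                    (∀ i j → i ≢ j → A i ⊥ A j) →
                    partialSum (λ n → Pr (A n)) ⟶ Pr (⋃ ℕ A)

  data Borel {T : ℕ} : Pred (Fin T → ℝ) 0ℓ → Set₁ where
    half-space : ∀ t r → Borel (λ y → y t ≤ r)
    complement : ∀ {S} → Borel S → Borel (∁ S)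
    union      : (S : ℕ → Pred (Fin T → ℝ) 0ℓ) → (∀ n → Borel (S n)) →
                 Borel (⋃ ℕ S)
    resp       : ∀ {S S′} → S ≐ S′ → Borel S → Borel S′

  -- ω is the outcome of all random choices of the algorithm.  By `online`,
  -- the output at time t depends only on ω and on the graphs up to time t,
  -- and on these only as sets of nodes and edges.

  record Algorithm (W T : ℕ) : Set₂ where
    field
      space : ProbabilitySpace

    open ProbabilitySpace space public

    field
      output     : IncrementalSequence W T → Ω → (Fin T → ℝ)
      measurable : ∀ 𝒢 t r → IsEvent (λ ω → output 𝒢 ω t ≤ r)
      online     : ∀ {𝒢 𝒢′} t → SameUpTo t 𝒢 𝒢′ →
                   ∀ ω → output 𝒢 ω t ≈ output 𝒢′ ω t

  module _ {W T : ℕ} (𝒜 : Algorithm W T) where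
    open Algorithm 𝒜

    EdgeDifferentiallyPrivate : ℝ → Set₁
    EdgeDifferentiallyPrivate ε =
      ∀ 𝒢 𝒢′ → EdgeAdjacent 𝒢 𝒢′ → (S : Pred (Fin T → ℝ) 0ℓ) → Borel S →
      Pr (λ ω → S (output 𝒢 ω)) ≤ exp ε * Pr (λ ω → S (output 𝒢′ ω))

    -- The quantification over m just names the true value at time t.
    ErrorsAtMost : ℝ → IncrementalSequence W T → Pred Ω 0ℓ
    ErrorsAtMost α 𝒢 ω =
      ∀ t m → IsMaximumMatchingWeight (G 𝒢 (Fin.suc t)) m →
      ∣ output 𝒢 ω t - fromℕ m ∣ ≤ α

    -- On every input, with failure probability at most β, the additive
    -- error is at most α at all time steps simultaneously.
    HasAdditiveError : ℝ → ℝ → Set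
    HasAdditiveError α β = ∀ 𝒢 → 1# - β ≤ Pr (ErrorsAtMost α 𝒢)

{-# OPTIONS --safe #-}
module Submission where

-- Packing.  At one of the T time steps, insert k disjoint edges of weight W,
-- and nothing at the other steps; compare these T inputs with the one where
-- nothing is ever inserted.  If the error is α < kW/2, the first output above
-- α reveals the step of the insertion, so T disjoint output events have
-- probability at least 1 − β each on their own input.  By group privacy each
-- has probability at least (1 − β) e^(−kε) on the empty input, whence
-- T (1 − β) ≤ e^(kε).  This fails for k a small multiple of log T, so α ≥ kW/2.

open import Level using (0ℓ)
import Algebra.Properties.Ring as RingProperties
import Algebra.Properties.Semiring.Mult as SemiringMult
open import Axiom.ExcludedMiddle using (ExcludedMiddle)
open import Data.Fin.Base as Fin using (Fin; toℕ; fromℕ<)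
import Data.Fin.Properties as Fin
open import Data.List.Base using (List; []; _∷_; length; lookup; applyUpTo; upTo)
open import Data.List.Membership.Propositional using (_∈_)
open import Data.List.Membership.Propositional.Properties
  using (∈-lookup; ∈-applyUpTo⁺; ∈-applyUpTo⁻; ∈-upTo⁺)
open import Data.List.Properties using (length-applyUpTo)
open import Data.List.Relation.Unary.All as All using (All; []; _∷_)
import Data.List.Relation.Unary.All.Properties as All
open import Data.List.Relation.Unary.AllPairs as AllPairs using (_∷_)
import Data.List.Relation.Unary.AllPairs.Properties as AllPairs
open import Data.List.Relation.Unary.Any using (index)
open import Data.List.Relation.Unary.Any.Properties using (lookup-index)
open import Data.List.Relation.Unary.Unique.Propositional using (Unique)
open import Data.Nat.Base as ℕ using (ℕ; zero; suc; z≤n; s≤s; z<s; s<s)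
open import Data.Nat.DivMod using (m≡m%n+[m/n]*n; m%n≤n; m/n*n≤m; m≥n⇒m/n>0)
open import Data.Nat.Logarithm using (⌈log₂_⌉; ⌈log₂⌉-mono-≤; ⌈log₂2^n⌉≡n)
import Data.Nat.Properties as ℕ
open import Data.Product.Base using (Σ; _×_; _,_; proj₁; proj₂)
open import Data.Sum.Base using (inj₁; inj₂)
open import Function.Base using (id; _∘_)
open import Relation.Binary.Bundles using (Poset)
open import Relation.Binary.Definitions using (tri<; tri≈; tri>)
open import Relation.Binary.PropositionalEquality.Core as ≡ using (_≡_; _≢_; cong; subst)
import Relation.Binary.Reasoning.PartialOrder as PartialOrderReasoning
open import Relation.Binary.Structures using (IsTotalOrder)
open import Relation.Nullary.Decidable.Core using (yes; no; decidable-stable)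
open import Relation.Nullary.Negation.Core using (¬_; contradiction)
open import Relation.Unary using (Pred; U; ∁; ⋃; _≐_; _⊆_; _∖_; _∩_; _⊥_)
open import Defs

-- Real numbers

module OrderedField (em : ExcludedMiddle 0ℓ) (F : CompleteOrderedField) where
  open CompleteOrderedField F
  open RingProperties ring
  open SemiringMult semiring using (×-homo-+; ×1-homo-*)
  open IsTotalOrder isTotalOrder public
    using (total; isPartialOrder; antisym)
    renaming (refl to ≤-refl; trans to ≤-trans; reflexive to ≤-reflexive)

  poset : Poset 0ℓ 0ℓ 0ℓ
  poset = record { isPartialOrder = isPartialOrder }

  module ≤-Reasoning = PartialOrderReasoning poset

  open ≤-Reasoning

  ≰⇒≥ : ∀ {x y} → ¬ x ≤ y → y ≤ x
  ≰⇒≥ {x} {y} x≰y with total x y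
  ... | inj₁ x≤y = contradiction x≤y x≰y
  ... | inj₂ y≤x = y≤x

  +-monoʳ-≤ : ∀ {x y} z → x ≤ y → z + x ≤ z + y
  +-monoʳ-≤ {x} {y} z x≤y = begin
    z + x ≈⟨ +-comm z x ⟩
    x + z ≤⟨ +-monoˡ-≤ z x≤y ⟩
    y + z ≈⟨ +-comm y z ⟩
    z + y ∎

  +-mono-≤ : ∀ {x y u v} → x ≤ y → u ≤ v → x + u ≤ y + v
  +-mono-≤ {y = y} {u} x≤y u≤v = ≤-trans (+-monoˡ-≤ u x≤y) (+-monoʳ-≤ y u≤v)

  x≤y+z⇒x-z≤y : ∀ {x y z} → x ≤ y + z → x - z ≤ y
  x≤y+z⇒x-z≤y {x} {y} {z} h = begin
    x - z       ≤⟨ +-monoˡ-≤ (- z) h ⟩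
    (y + z) - z ≈⟨ //-rightDividesʳ z y ⟩
    y           ∎

  x-z≤y⇒x≤y+z : ∀ {x y z} → x - z ≤ y → x ≤ y + z
  x-z≤y⇒x≤y+z {x} {y} {z} h = begin
    x           ≈⟨ //-rightDividesˡ z x ⟨
    (x - z) + z ≤⟨ +-monoˡ-≤ z h ⟩
    y + z       ∎

  x≤y-z⇒x+z≤y : ∀ {x y z} → x ≤ y - z → x + z ≤ y
  x≤y-z⇒x+z≤y {x} {y} {z} h = begin
    x + z       ≤⟨ +-monoˡ-≤ z h ⟩
    (y - z) + z ≈⟨ //-rightDividesˡ z y ⟩
    y           ∎

  x+z≤y⇒x≤y-z : ∀ {x y z} → x + z ≤ y → x ≤ y - z
  x+z≤y⇒x≤y-z {x} {y} {z} h = begin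
    x           ≈⟨ //-rightDividesʳ z x ⟨
    (x + z) - z ≤⟨ +-monoˡ-≤ (- z) h ⟩
    y - z       ∎

  x≤y⇒0≤y-x : ∀ {x y} → x ≤ y → 0# ≤ y - x
  x≤y⇒0≤y-x {x} x≤y = x+z≤y⇒x≤y-z (≤-trans (≤-reflexive (+-identityˡ x)) x≤y)

  0≤y-x⇒x≤y : ∀ {x y} → 0# ≤ y - x → x ≤ y
  0≤y-x⇒x≤y {x} h = ≤-trans (≤-reflexive (sym (+-identityˡ x))) (x≤y-z⇒x+z≤y h)

  +-cancelʳ-≤ : ∀ {x y} z → x + z ≤ y + z → x ≤ y
  +-cancelʳ-≤ {x} {y} z h = ≤-trans (x+z≤y⇒x≤y-z h) (≤-reflexive (//-rightDividesʳ z y))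

  x≤x+y : ∀ {x y} → 0# ≤ y → x ≤ x + y
  x≤x+y {x} {y} 0≤y = begin
    x      ≈⟨ +-identityʳ x ⟨
    x + 0# ≤⟨ +-monoʳ-≤ x 0≤y ⟩
    x + y  ∎

  neg-mono-≤ : ∀ {x y} → x ≤ y → - y ≤ - x
  neg-mono-≤ {x} {y} x≤y = begin
    - y           ≈⟨ +-identityˡ (- y) ⟨
    0# - y        ≤⟨ x≤y+z⇒x-z≤y (begin
      0#            ≈⟨ -‿inverseˡ x ⟨
      - x + x       ≤⟨ +-monoʳ-≤ (- x) x≤y ⟩
      - x + y       ∎) ⟩
    - x           ∎

  x≤0⇒0≤-x : ∀ {x} → x ≤ 0# → 0# ≤ - x
  x≤0⇒0≤-x {x} x≤0 = ≤-trans (≤-reflexive (sym -0#≈0#)) (neg-mono-≤ x≤0)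

  *-monoʳ-≤ : ∀ {x y z} → 0# ≤ z → x ≤ y → z * x ≤ z * y
  *-monoʳ-≤ {x} {y} {z} 0≤z x≤y = 0≤y-x⇒x≤y (begin
    0#              ≤⟨ *-nonNegative 0≤z (x≤y⇒0≤y-x x≤y) ⟩
    z * (y - x)     ≈⟨ x[y-z]≈xy-xz z y x ⟩
    z * y - z * x   ∎)

  *-monoˡ-≤ : ∀ {x y z} → 0# ≤ z → x ≤ y → x * z ≤ y * z
  *-monoˡ-≤ {x} {y} {z} 0≤z x≤y = begin
    x * z ≈⟨ *-comm x z ⟩
    z * x ≤⟨ *-monoʳ-≤ 0≤z x≤y ⟩
    z * y ≈⟨ *-comm z y ⟩
    y * z ∎

  -- In the second case `1# ≤ 0#` makes -1 nonnegative, hence also its square, which is 1.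
  0≤1 : 0# ≤ 1#
  0≤1 with total 0# 1#
  ... | inj₁ h = h
  ... | inj₂ 1≤0 = begin
    0#           ≤⟨ *-nonNegative (x≤0⇒0≤-x 1≤0) (x≤0⇒0≤-x 1≤0) ⟩
    - 1# * - 1#  ≈⟨ -1*x≈-x (- 1#) ⟩
    - (- 1#)     ≈⟨ -‿involutive 1# ⟩
    1#           ∎

  1≰0 : ¬ 1# ≤ 0#
  1≰0 1≤0 = 0≉1 (antisym 0≤1 1≤0)

  <⇒≰ : ∀ {x y} → x < y → ¬ y ≤ x
  <⇒≰ (x≤y , x≉y) y≤x = x≉y (antisym x≤y y≤x)

  ≰⇒> : ∀ {x y} → ¬ x ≤ y → y < x
  ≰⇒> x≰y = ≰⇒≥ x≰y , λ y≈x → x≰y (≤-reflexive (sym y≈x))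

  <⇒≉0 : ∀ {x} → 0# < x → ¬ x ≈ 0#
  <⇒≉0 (_ , 0≉x) x≈0 = 0≉x (sym x≈0)

  0<x⇒0<x⁻¹ : ∀ {x} → 0# < x → 0# < x ⁻¹
  0<x⇒0<x⁻¹ {x} 0<x@(0≤x , _) = ≰⇒> λ x⁻¹≤0 → 1≰0 (begin
    1#       ≈⟨ *-inverseʳ (<⇒≉0 0<x) ⟨
    x * x ⁻¹ ≤⟨ *-monoʳ-≤ 0≤x x⁻¹≤0 ⟩
    x * 0#   ≈⟨ zeroʳ x ⟩
    0#       ∎)

  x<y⇒0<y-x : ∀ {x y} → x < y → 0# < y - x
  x<y⇒0<y-x x<y = ≰⇒> λ h →
    <⇒≰ x<y (≤-trans (x-z≤y⇒x≤y+z h) (≤-reflexive (+-identityˡ _)))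

  ∣x∣≤y⇒x≤y : ∀ {x y} → ∣ x ∣ ≤ y → x ≤ y
  ∣x∣≤y⇒x≤y {x} {y} h with total 0# x
  ... | inj₁ _   = h
  ... | inj₂ x≤0 = begin
    x   ≤⟨ x≤0 ⟩
    0#  ≤⟨ x≤0⇒0≤-x x≤0 ⟩
    - x ≤⟨ h ⟩
    y   ∎

  ∣x∣≤y⇒-x≤y : ∀ {x y} → ∣ x ∣ ≤ y → - x ≤ y
  ∣x∣≤y⇒-x≤y {x} {y} h with total 0# x
  ... | inj₂ _   = h
  ... | inj₁ 0≤x = begin
    - x  ≤⟨ neg-mono-≤ 0≤x ⟩
    - 0# ≈⟨ -0#≈0# ⟩
    0#   ≤⟨ 0≤x ⟩
    x    ≤⟨ h ⟩
    y    ∎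

  ∣∣≤⁺ : ∀ {x y} → x ≤ y → - x ≤ y → ∣ x ∣ ≤ y
  ∣∣≤⁺ {x} x≤y -x≤y with total 0# x
  ... | inj₁ _ = x≤y
  ... | inj₂ _ = -x≤y

  ∣x-y∣≤z⇒x≤z+y : ∀ {x y z} → ∣ x - y ∣ ≤ z → x ≤ z + y
  ∣x-y∣≤z⇒x≤z+y h = x-z≤y⇒x≤y+z (∣x∣≤y⇒x≤y h)

  ∣x-y∣≤z⇒y≤z+x : ∀ {x y z} → ∣ x - y ∣ ≤ z → y ≤ z + x
  ∣x-y∣≤z⇒y≤z+x {x} {y} h =
    x-z≤y⇒x≤y+z (≤-trans (≤-reflexive (sym (⁻¹-anti-homo‿- x y))) (∣x∣≤y⇒-x≤y h))

  ∣x-y∣≤z⁺ : ∀ {x y z} → x ≤ z + y → y ≤ z + x → ∣ x - y ∣ ≤ z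
  ∣x-y∣≤z⁺ {x} {y} p q = ∣∣≤⁺ (x≤y+z⇒x-z≤y p)
    (≤-trans (≤-reflexive (⁻¹-anti-homo‿- x y)) (x≤y+z⇒x-z≤y q))

  ½ : ℝ
  ½ = (1# + 1#) ⁻¹

  0<2 : 0# < 1# + 1#
  0<2 = ≰⇒> λ h → 1≰0 (≤-trans (x≤x+y 0≤1) h)

  half+half : ∀ x → x * ½ + x * ½ ≈ x
  half+half x = begin-equality
    x * ½ + x * ½             ≈⟨ distribˡ x ½ ½ ⟨
    x * (½ + ½)               ≈⟨ *-congˡ (+-cong (*-identityˡ ½) (*-identityˡ ½)) ⟨
    x * (1# * ½ + 1# * ½)     ≈⟨ *-congˡ (distribʳ ½ 1# 1#) ⟨
    x * ((1# + 1#) * ½)       ≈⟨ *-congˡ (*-inverseʳ (<⇒≉0 0<2)) ⟩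
    x * 1#                    ≈⟨ *-identityʳ x ⟩
    x                         ∎

  -- Otherwise `d = x - y` is positive, and δ = d/2 would give d ≤ d/2.
  ≤+δ⇒≤ : ∀ {x y} → (∀ δ → 0# < δ → x ≤ y + δ) → x ≤ y
  ≤+δ⇒≤ {x} {y} h = decidable-stable em λ x≰y →
    let
      d = x - y
      0<d = x<y⇒0<y-x (≰⇒> x≰y)
      0<dh : 0# < d * ½
      0<dh = ≰⇒> λ dh≤0 → <⇒≰ 0<d (begin
        d               ≈⟨ half+half d ⟨
        d * ½ + d * ½   ≤⟨ +-mono-≤ dh≤0 dh≤0 ⟩
        0# + 0#         ≈⟨ +-identityˡ 0# ⟩
        0#              ∎)
    in <⇒≰ 0<dh (+-cancelʳ-≤ (d * ½) (begin
      d * ½ + d * ½     ≈⟨ half+half d ⟩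
      d                 ≤⟨ x≤y+z⇒x-z≤y (≤-trans (h (d * ½) 0<dh) (≤-reflexive (+-comm y _))) ⟩
      d * ½             ≈⟨ +-identityˡ _ ⟨
      0# + d * ½        ∎))

  -- Natural numbers in the field and the Archimedean property.

  fromℕ-homo-+ : ∀ m n → fromℕ (m ℕ.+ n) ≈ fromℕ m + fromℕ n
  fromℕ-homo-+ = ×-homo-+ 1#

  fromℕ-homo-* : ∀ m n → fromℕ (m ℕ.* n) ≈ fromℕ m * fromℕ n
  fromℕ-homo-* = ×1-homo-*

  0≤fromℕ : ∀ n → 0# ≤ fromℕ n
  0≤fromℕ zero    = ≤-refl
  0≤fromℕ (suc n) = ≤-trans 0≤1 (x≤x+y (0≤fromℕ n))

  fromℕ-mono-≤ : ∀ {m n} → m ℕ.≤ n → fromℕ m ≤ fromℕ n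
  fromℕ-mono-≤ {n = n} ℕ.z≤n = 0≤fromℕ n
  fromℕ-mono-≤ (ℕ.s≤s m≤n)   = +-monoʳ-≤ 1# (fromℕ-mono-≤ m≤n)

  0<fromℕ-suc : ∀ n → 0# < fromℕ (suc n)
  0<fromℕ-suc n = ≰⇒> λ h → 1≰0 (≤-trans (x≤x+y (0≤fromℕ n)) h)

  fromℕ-cancel-≤ : ∀ {m n} → fromℕ m ≤ fromℕ n → m ℕ.≤ n
  fromℕ-cancel-≤ {m} {n} h = ℕ.≮⇒≥ λ n<m → 1≰0 (+-cancelʳ-≤ (fromℕ n) (begin
    1# + fromℕ n ≤⟨ fromℕ-mono-≤ n<m ⟩
    fromℕ m      ≤⟨ h ⟩
    fromℕ n      ≈⟨ +-identityˡ _ ⟨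
    0# + fromℕ n ∎))

  -- Otherwise the naturals are bounded and have a supremum `s`. Since n + 1 ≤ s for every n,
  -- `s - 1#` is an upper bound too, which is absurd.
  archimedean : ∀ x → Σ ℕ λ n → x ≤ fromℕ n
  archimedean x = decidable-stable em λ unbounded →
    let
      s , ub , lub = complete
        (λ y → Σ ℕ λ n → y ≈ fromℕ n) (0# , 0 , refl)
        (x , λ { y (n , y≈n) → ≤-trans (≤-reflexive y≈n) (≰⇒≥ λ x≤n → unbounded (n , x≤n)) })
      s≤s-1 : s ≤ s - 1#
      s≤s-1 = lub (s - 1#) λ { y (n , y≈n) → x+z≤y⇒x≤y-z (begin
        y + 1#        ≈⟨ +-comm y 1# ⟩
        1# + y        ≈⟨ +-congˡ y≈n ⟩
        fromℕ (suc n) ≤⟨ ub (fromℕ (suc n)) (suc n , refl) ⟩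
        s             ∎) }
    in 1≰0 (+-cancelʳ-≤ s (begin
      1# + s  ≈⟨ +-comm 1# s ⟩
      s + 1#  ≤⟨ x≤y-z⇒x+z≤y s≤s-1 ⟩
      s       ≈⟨ +-identityˡ s ⟨
      0# + s  ∎))

  inverse-archimedean : ∀ {x} → 0# < x → Σ ℕ λ n → 1# ≤ fromℕ n * x
  inverse-archimedean {x} 0<x@(0≤x , _) with archimedean (x ⁻¹)
  ... | n , h = n , (begin
    1#          ≈⟨ *-inverseʳ (<⇒≉0 0<x) ⟨
    x * x ⁻¹    ≈⟨ *-comm x _ ⟩
    x ⁻¹ * x    ≤⟨ *-monoˡ-≤ 0≤x h ⟩
    fromℕ n * x ∎)

  -- Series with nonnegative terms and the exponential.

  module _ {a b : ℕ → ℝ} (a≤b : ∀ n → a n ≤ b n) where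

    partialSum-mono-≤ : ∀ n → partialSum a n ≤ partialSum b n
    partialSum-mono-≤ zero    = ≤-refl
    partialSum-mono-≤ (suc n) = +-mono-≤ (partialSum-mono-≤ n) (a≤b n)

  module _ {a : ℕ → ℝ} (0≤a : ∀ n → 0# ≤ a n) where

    partialSum-increasing : ∀ {m n} → m ℕ.≤′ n → partialSum a m ≤ partialSum a n
    partialSum-increasing (ℕ.≤′-reflexive ≡.refl) = ≤-refl
    partialSum-increasing (ℕ.≤′-step m≤′n)        =
      ≤-trans (partialSum-increasing m≤′n) (x≤x+y (0≤a _))

    -- Up to any δ, compare at the index `n ⊔ N`, which lies beyond both `n` and the point from
    -- which the sums are δ-close to `l`.
    partialSum≤limit : ∀ {l} → partialSum a ⟶ l → ∀ n → partialSum a n ≤ l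
    partialSum≤limit {l} a⟶l n = ≤+δ⇒≤ λ δ 0<δ →
      let N , close = a⟶l δ 0<δ
      in begin
        partialSum a n           ≤⟨ partialSum-increasing (ℕ.≤⇒≤′ (ℕ.m≤m⊔n n N)) ⟩
        partialSum a (n ℕ.⊔ N)   ≤⟨ ∣x-y∣≤z⇒x≤z+y (close (n ℕ.⊔ N) (ℕ.m≤n⊔m n N)) ⟩
        δ + l                    ≈⟨ +-comm δ l ⟩
        l + δ                    ∎

  limit≤bound : ∀ {a : ℕ → ℝ} {l b} → a ⟶ l → (∀ n → a n ≤ b) → l ≤ b
  limit≤bound {a} {l} {b} a⟶l a≤b = ≤+δ⇒≤ λ δ 0<δ →
    let N , close = a⟶l δ 0<δ
    in begin
      l       ≤⟨ ∣x-y∣≤z⇒y≤z+x (close N ℕ.≤-refl) ⟩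
      δ + a N ≤⟨ +-monoʳ-≤ δ (a≤b N) ⟩
      δ + b   ≈⟨ +-comm δ b ⟩
      b + δ   ∎

  expTerm-ratio-nonneg : ∀ {x} n → 0# ≤ x → 0# ≤ x * fromℕ (suc n) ⁻¹
  expTerm-ratio-nonneg n 0≤x = *-nonNegative 0≤x (proj₁ (0<x⇒0<x⁻¹ (0<fromℕ-suc n)))

  expTerm-nonneg : ∀ {x} → 0# ≤ x → ∀ n → 0# ≤ expTerm x n
  expTerm-nonneg 0≤x zero    = 0≤1
  expTerm-nonneg 0≤x (suc n) =
    *-nonNegative (expTerm-nonneg 0≤x n) (expTerm-ratio-nonneg n 0≤x)

  expTerm-mono-≤ : ∀ {x y} → 0# ≤ x → x ≤ y → ∀ n → expTerm x n ≤ expTerm y n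
  expTerm-mono-≤ 0≤x x≤y zero    = ≤-refl
  expTerm-mono-≤ {x} {y} 0≤x x≤y (suc n) = begin
    expTerm x n * (x * r) ≤⟨ *-monoˡ-≤ (expTerm-ratio-nonneg n 0≤x) (expTerm-mono-≤ 0≤x x≤y n) ⟩
    expTerm y n * (x * r) ≤⟨ *-monoʳ-≤ (expTerm-nonneg (≤-trans 0≤x x≤y) n) (*-monoˡ-≤ 0≤r x≤y) ⟩
    expTerm y n * (y * r) ∎
    where
    r = fromℕ (suc n) ⁻¹
    0≤r = proj₁ (0<x⇒0<x⁻¹ (0<fromℕ-suc n))

module Exponential (em : ExcludedMiddle 0ℓ) (R : RealNumbers) where
  open RealNumbers R
  open OrderedField em completeOrderedField

  -- For nonnegative arguments the power series have nonnegative terms and compare term by term. It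
  -- makes one bound on `exp ε₀` serve all ε in (0, ε₀].
  exp-mono-≤ : ∀ {x y} → 0# ≤ x → x ≤ y → exp x ≤ exp y
  exp-mono-≤ {x} {y} 0≤x x≤y = limit≤bound (exp-series x) λ n →
    ≤-trans (partialSum-mono-≤ (expTerm-mono-≤ 0≤x x≤y) n)
            (partialSum≤limit (expTerm-nonneg (≤-trans 0≤x x≤y)) (exp-series y) n)

-- Probability

-- Instantiated twice, by the events of a probability space and by the Borel sets of output
-- sequences, so that the closure properties are shared.
record IsSigmaAlgebra {Ω : Set} (M : Pred Ω 0ℓ → Set₁) : Set₁ where
  field
    resp : ∀ {A B} → A ≐ B → M A → M B
    full : M U
    comp : ∀ {A} → M A → M (∁ A)
    ⋃ℕ   : (A : ℕ → Pred Ω 0ℓ) → (∀ n → M (A n)) → M (⋃ ℕ A)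

module SigmaAlgebra (em : ExcludedMiddle 0ℓ) {Ω : Set} {M : Pred Ω 0ℓ → Set₁}
                    (isSigmaAlgebra : IsSigmaAlgebra M) where
  open IsSigmaAlgebra isSigmaAlgebra

  const-measurable : (P : Set) → M (λ _ → P)
  const-measurable P with em {P}
  ... | yes p = resp ((λ _ → p) , _) full
  ... | no ¬p = resp ((λ u∉ → contradiction _ u∉) , λ p → contradiction p ¬p) (comp full)

  ⋂ℕ : (A : ℕ → Pred Ω 0ℓ) → (∀ n → M (A n)) → M (λ ω → ∀ n → A n ω)
  ⋂ℕ A A∈M = resp
    ((λ h n → decidable-stable em λ ¬a → h (n , ¬a)) , λ h (n , ¬a) → ¬a (h n))
    (comp (⋃ℕ (λ n → ∁ (A n)) (λ n → comp (A∈M n))))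

  ∩-measurable : ∀ {A B} → M A → M B → M (A ∩ B)
  ∩-measurable {A} {B} A∈M B∈M = resp
    ((λ h → h 0 , h 1) , λ { (a , b) zero → a ; (a , b) (suc _) → b })
    (⋂ℕ (λ { zero → A ; (suc _) → B }) λ { zero → A∈M ; (suc _) → B∈M })

  -- As `P` does not depend on `ω`, the set is either `A` or everything. This serves the premise of
  -- `ErrorsAtMost` and the bounded quantifier in `Detects`.
  ⇒-measurable : ∀ {A} (P : Set) → M A → M (λ ω → P → A ω)
  ⇒-measurable P A∈M with em {P}
  ... | yes p = resp ((λ a _ → a) , λ h → h p) A∈M
  ... | no ¬p = resp ((λ _ p → contradiction p ¬p) , _) full

  ⋂Fin : ∀ {n} (A : Fin n → Pred Ω 0ℓ) → (∀ i → M (A i)) → M (λ ω → ∀ i → A i ω)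
  ⋂Fin {zero}  A A∈M = resp ((λ _ ()) , _) full
  ⋂Fin {suc n} A A∈M = resp
    ((λ { (a , h) Fin.zero → a ; (a , h) (Fin.suc i) → h i }) ,
     λ h → h Fin.zero , λ i → h (Fin.suc i))
    (∩-measurable (A∈M Fin.zero) (⋂Fin (A ∘ Fin.suc) (A∈M ∘ Fin.suc)))

module Probability (em : ExcludedMiddle 0ℓ) (R : RealNumbers)
                   (space : Privacy.ProbabilitySpace R) where
  open RealNumbers R
  open OrderedField em completeOrderedField
  open Privacy.ProbabilitySpace space
  open ≤-Reasoning

  event-isSigmaAlgebra : IsSigmaAlgebra IsEvent
  event-isSigmaAlgebra = record
    { resp = event-resp ; full = event-U ; comp = event-∁ ; ⋃ℕ = event-⋃ }

  open SigmaAlgebra em event-isSigmaAlgebra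

  -- All later uses of σ-additivity go through this inequality: with nonnegative terms, a finite sum
  -- stays below the limit.
  partialSum≤Pr-⋃ : (A : ℕ → Pred Ω 0ℓ) → (∀ n → IsEvent (A n)) →
                    (∀ i j → i ≢ j → A i ⊥ A j) →
                    ∀ n → partialSum (Pr ∘ A) n ≤ Pr (⋃ ℕ A)
  partialSum≤Pr-⋃ A event disjoint =
    partialSum≤limit (Pr-nonNeg ∘ event) (σ-additive A event disjoint)

  Pr-mono-≤ : ∀ {A B} → IsEvent A → IsEvent B → A ⊆ B → Pr A ≤ Pr B
  Pr-mono-≤ {A} {B} A-event B-event A⊆B = begin
    Pr A                      ≈⟨ +-identityˡ (Pr A) ⟨
    partialSum (Pr ∘ D) 1     ≤⟨ partialSum≤Pr-⋃ D D-event D-disjoint 1 ⟩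
    Pr (⋃ ℕ D)                ≈⟨ Pr-cong (event-⋃ D D-event) ⋃D≐B ⟩
    Pr B                      ∎
    where
    D : ℕ → Pred Ω 0ℓ
    D zero    = A
    -- The condition `n ≡ 0` makes the disjoint family `A`, `B` minus `A`, and then empty sets; its
    -- first partial sum is already `Pr A`.
    D (suc n) = λ ω → (B ∖ A) ω × n ≡ 0

    D-event : ∀ n → IsEvent (D n)
    D-event zero    = A-event
    D-event (suc n) =
      ∩-measurable (∩-measurable B-event (event-∁ A-event)) (const-measurable (n ≡ 0))

    D-disjoint : ∀ i j → i ≢ j → D i ⊥ D j
    D-disjoint zero    zero    i≢j _ = i≢j ≡.refl
    D-disjoint zero    (suc j) _   (a , (_ , ¬a) , _) = ¬a a
    D-disjoint (suc i) zero    _   (((_ , ¬a) , _) , a) = ¬a a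
    D-disjoint (suc i) (suc j) i≢j ((_ , ≡.refl) , (_ , ≡.refl)) = i≢j ≡.refl

    ⋃D≐B : ⋃ ℕ D ≐ B
    ⋃D≐B = (λ { (zero , a) → A⊆B a ; (suc _ , (b , _) , _) → b }) , split
      where
      split : B ⊆ ⋃ ℕ D
      split {ω} b with em {A ω}
      ... | yes a = 0 , a
      ... | no ¬a = 1 , (b , ¬a) , ≡.refl

  Pr≤1 : ∀ {A} → IsEvent A → Pr A ≤ 1#
  Pr≤1 {A} A-event = begin
    Pr A ≤⟨ Pr-mono-≤ A-event event-U _ ⟩
    Pr U ≈⟨ Pr-U ⟩
    1#   ∎

  -- Summing the `T` hypotheses gives T p on the left and, on the right, q times a sum of
  -- probabilities of disjoint events, which is at most 1.
  disjoint-packing : ∀ {T} (A : Fin T → Pred Ω 0ℓ) → (∀ t → IsEvent (A t)) →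
    (∀ s t → s ≢ t → A s ⊥ A t) →
    ∀ {p q} → 0# ≤ q → (∀ t → p ≤ q * Pr (A t)) → fromℕ T * p ≤ q
  disjoint-packing {T} A A-event A-disjoint {p} {q} 0≤q p≤qPr = begin
    fromℕ T * p                 ≤⟨ lower T ℕ.≤-refl ⟩
    q * partialSum (Pr ∘ D) T   ≤⟨ *-monoʳ-≤ 0≤q (partialSum≤Pr-⋃ D D-event D-disjoint T) ⟩
    q * Pr (⋃ ℕ D)              ≤⟨ *-monoʳ-≤ 0≤q (Pr≤1 (event-⋃ D D-event)) ⟩
    q * 1#                      ≈⟨ *-identityʳ q ⟩
    q                           ∎
    where
    -- The finite family continued by empty sets beyond `T`, as σ-additivity asks for a sequence.
    D : ℕ → Pred Ω 0ℓ
    D n ω = Σ (Fin T) λ t → toℕ t ≡ n × A t ω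

    A≐D : ∀ {n} (n<T : n ℕ.< T) → A (fromℕ< n<T) ≐ D n
    A≐D {n} n<T = (λ a → fromℕ< n<T , Fin.toℕ-fromℕ< n<T , a) ,
      λ { {ω} (t , ≡.refl , a) → subst (λ s → A s ω) (≡.sym (Fin.fromℕ<-toℕ t n<T)) a }

    D-event : ∀ n → IsEvent (D n)
    D-event n with n ℕ.<? T
    ... | yes n<T = event-resp (A≐D n<T) (A-event (fromℕ< n<T))
    ... | no  n≮T = event-resp
      ((λ u∉ → contradiction _ u∉) , λ { (t , ≡.refl , _) → contradiction (Fin.toℕ<n t) n≮T })
      (event-∁ event-U)

    D-disjoint : ∀ i j → i ≢ j → D i ⊥ D j
    D-disjoint i j i≢j ((s , ≡.refl , a) , (t , ≡.refl , a′)) =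
      A-disjoint s t (λ { ≡.refl → i≢j ≡.refl }) (a , a′)

    lower : ∀ n → n ℕ.≤ T → fromℕ n * p ≤ q * partialSum (Pr ∘ D) n
    lower zero    _   = ≤-reflexive (trans (zeroˡ p) (sym (zeroʳ q)))
    lower (suc n) n<T = begin
      (1# + fromℕ n) * p                          ≈⟨ distribʳ p 1# (fromℕ n) ⟩
      1# * p + fromℕ n * p                        ≈⟨ +-comm _ _ ⟩
      fromℕ n * p + 1# * p                        ≈⟨ +-congˡ (*-identityˡ p) ⟩
      fromℕ n * p + p                             ≤⟨ +-mono-≤ (lower n (ℕ.<⇒≤ n<T)) (p≤qPr (fromℕ< n<T)) ⟩
      q * partialSum (Pr ∘ D) n + q * Pr (A (fromℕ< n<T))
        ≈⟨ +-congˡ (*-congˡ (Pr-cong (A-event (fromℕ< n<T)) (A≐D n<T))) ⟩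
      q * partialSum (Pr ∘ D) n + q * Pr (D n)    ≈⟨ distribˡ q _ _ ⟨
      q * (partialSum (Pr ∘ D) n + Pr (D n))      ∎

  module _ {X : Ω → ℝ} (X-measurable : ∀ r → IsEvent (λ ω → X ω ≤ r)) where

    -- The complement {X < r} is the union of the events X ≤ r − 1/(n+1).
    ≥-measurable : ∀ r → IsEvent (λ ω → r ≤ X ω)
    ≥-measurable r = event-resp (to , from)
      (event-∁ (event-⋃ (λ n ω → X ω ≤ r - δ n) (λ n → X-measurable (r - δ n))))
      where
      δ : ℕ → ℝ
      δ n = fromℕ (suc n) ⁻¹

      to : ∀ {ω} → ¬ Σ ℕ (λ n → X ω ≤ r - δ n) → r ≤ X ω
      to {ω} h = decidable-stable em λ r≰X →
        let
          d = r - X ω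
          0<d = x<y⇒0<y-x (≰⇒> r≰X)
          -- From 1 ≤ n d follows 1/(n+1) ≤ d, so `ω` lies in the `n`-th set of the union.
          n , 1≤nd = inverse-archimedean 0<d
          δn≤d : δ n ≤ d
          δn≤d = begin
            δ n                         ≈⟨ *-identityʳ (δ n) ⟨
            δ n * 1#                    ≤⟨ *-monoʳ-≤ (0≤δ n) 1≤nd ⟩
            δ n * (fromℕ n * d)         ≤⟨ *-monoʳ-≤ (0≤δ n) (*-monoˡ-≤ (proj₁ 0<d) (fromℕ-mono-≤ (ℕ.n≤1+n n))) ⟩
            δ n * (fromℕ (suc n) * d)   ≈⟨ *-assoc _ _ d ⟨
            δ n * fromℕ (suc n) * d     ≈⟨ *-congʳ (trans (*-comm _ _) (*-inverseʳ (<⇒≉0 (0<fromℕ-suc n)))) ⟩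
            1# * d                      ≈⟨ *-identityˡ d ⟩
            d                           ∎
        in h (n , x+z≤y⇒x≤y-z (begin
          X ω + δ n ≈⟨ +-comm _ _ ⟩
          δ n + X ω ≤⟨ x≤y-z⇒x+z≤y δn≤d ⟩
          r         ∎))
        where
        0≤δ : ∀ n → 0# ≤ δ n
        0≤δ n = proj₁ (0<x⇒0<x⁻¹ (0<fromℕ-suc n))

      from : ∀ {ω} → r ≤ X ω → ¬ Σ ℕ (λ n → X ω ≤ r - δ n)
      from {ω} r≤X (n , X≤r-δ) = <⇒≰ (0<x⇒0<x⁻¹ (0<fromℕ-suc n)) (+-cancelʳ-≤ r (begin
        δ n + r   ≈⟨ +-comm _ _ ⟩
        r + δ n   ≤⟨ +-monoˡ-≤ (δ n) r≤X ⟩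
        X ω + δ n ≤⟨ x≤y-z⇒x+z≤y X≤r-δ ⟩
        r         ≈⟨ +-identityˡ r ⟨
        0# + r    ∎))

    ∣-∣≤-measurable : ∀ a r → IsEvent (λ ω → ∣ X ω - a ∣ ≤ r)
    ∣-∣≤-measurable a r = event-resp
      ((λ (p , q) → ∣x-y∣≤z⁺ p (≤-trans (x-z≤y⇒x≤y+z q) (≤-reflexive (+-comm _ _)))) ,
       λ h → ∣x-y∣≤z⇒x≤z+y h ,
             x≤y+z⇒x-z≤y (≤-trans (∣x-y∣≤z⇒y≤z+x h) (≤-reflexive (+-comm _ _))))
      (∩-measurable (X-measurable (r + a)) (≥-measurable (a - r)))

-- Borel sets of output sequences.

module _ (em : ExcludedMiddle 0ℓ) (R : RealNumbers) {T : ℕ} (t : Fin T) where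
  open RealNumbers R
  open Privacy R

  -- `Borel` has no constructor for the full set: it is a half-space joined
  -- with its complement, which requires T to be positive.
  Borel-isSigmaAlgebra : IsSigmaAlgebra (Borel {T})
  Borel-isSigmaAlgebra = record
    { resp = resp
    ; full = resp (_ , λ {y} _ → cover y) (union H∪∁H H∪∁H-Borel)
    ; comp = complement
    ; ⋃ℕ   = union
    }
    where
    H : Pred (Fin T → ℝ) 0ℓ
    H y = y t ≤ 0#

    H∪∁H : ℕ → Pred (Fin T → ℝ) 0ℓ
    H∪∁H zero    = H
    H∪∁H (suc _) = ∁ H

    H∪∁H-Borel : ∀ n → Borel (H∪∁H n)
    H∪∁H-Borel zero    = half-space t 0#
    H∪∁H-Borel (suc _) = complement (half-space t 0#)

    cover : ∀ y → ⋃ ℕ H∪∁H y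
    cover y with em {H y}
    ... | yes h = 0 , h
    ... | no ¬h = 1 , ¬h

-- Graph sequences with one burst of disjoint edges

Unique⇒lookup-injective : ∀ {a} {A : Set a} {xs : List A} → Unique xs →
                          ∀ i j → lookup xs i ≡ lookup xs j → i ≡ j
Unique⇒lookup-injective (_ ∷ _)    Fin.zero    Fin.zero    _  = ≡.refl
Unique⇒lookup-injective (x∉xs ∷ _) Fin.zero    (Fin.suc j) eq =
  contradiction eq (All.lookup x∉xs (∈-lookup j))
Unique⇒lookup-injective (x∉xs ∷ _) (Fin.suc i) Fin.zero    eq =
  contradiction (≡.sym eq) (All.lookup x∉xs (∈-lookup i))
Unique⇒lookup-injective (_ ∷ u)    (Fin.suc i) (Fin.suc j) eq =
  cong Fin.suc (Unique⇒lookup-injective u i j eq)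

-- Pigeonhole: sending each position of `xs` to a position of the same element in `ys` is injective,
-- because `xs` has no repetitions.
Unique⇒length≤ : ∀ {a} {A : Set a} {xs ys : List A} → Unique xs → All (_∈ ys) xs →
                 length xs ℕ.≤ length ys
Unique⇒length≤ {xs = xs} {ys} u xs⊆ys = Fin.injective⇒≤ {f = f} λ {i} {j} eq →
  Unique⇒lookup-injective u i j
    (≡.trans (lookup-index (member i)) (≡.trans (cong (lookup ys) eq) (≡.sym (lookup-index (member j)))))
  where
  member : ∀ i → lookup xs i ∈ ys
  member i = All.lookup xs⊆ys (∈-lookup i)
  f : Fin (length xs) → Fin (length ys)
  f i = index (member i)

-- `at n` is the number of edges present at time n; the step t : Fin T leads
-- from time t to time suc t.
record Profile (k : ℕ) : Set where
  field
    at         : ℕ → ℕ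
    increasing : ∀ n → at n ℕ.≤ at (suc n)
    bounded    : ∀ n → at n ℕ.≤ k

open Profile using (at; increasing; bounded)

-- A property of arbitrary profiles, so that `quiet` counts as a burst of size 0 at every `t`. Then
-- removing the last edge of a burst is an instance of `burst-lacksOneEdge`.
IsBurst : ∀ {k} → ℕ → ℕ → Profile k → Set
IsBurst t j c = (∀ {n} → n ℕ.≤ t → at c n ≡ 0) × (∀ {n} → t ℕ.< n → at c n ≡ j)

quiet : ∀ {k} → Profile k
quiet = record { at = λ _ → 0 ; increasing = λ _ → z≤n ; bounded = λ _ → z≤n }

burst : ∀ {k} → ℕ → ∀ j → j ℕ.≤ k → Profile k
burst {k} t j j≤k = record { at = count t ; increasing = count-increasing t ; bounded = count-bounded t }
  where
  count : ℕ → ℕ → ℕ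
  count t       zero    = 0
  count zero    (suc n) = j
  count (suc t) (suc n) = count t n

  count-increasing : ∀ t n → count t n ℕ.≤ count t (suc n)
  count-increasing t       zero    = z≤n
  count-increasing zero    (suc n) = ℕ.≤-refl
  count-increasing (suc t) (suc n) = count-increasing t n

  count-bounded : ∀ t n → count t n ℕ.≤ k
  count-bounded t       zero    = z≤n
  count-bounded zero    (suc n) = j≤k
  count-bounded (suc t) (suc n) = count-bounded t n

burst-isBurst : ∀ {k} t {j} (j≤k : j ℕ.≤ k) → IsBurst t j (burst t j j≤k)
burst-isBurst {k} t {j} j≤k = before t , after t
  where
  before : ∀ t {n} → n ℕ.≤ t → at (burst t j j≤k) n ≡ 0
  before t       z≤n       = ≡.refl
  before (suc t) (s≤s n≤t) = before t n≤t

  after : ∀ t {n} → t ℕ.< n → at (burst t j j≤k) n ≡ j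
  after zero    z<s       = ≡.refl
  after (suc t) (s<s t<n) = after t t<n

module DisjointEdges (W : ℕ) (1≤W : 1 ℕ.≤ W) (k : ℕ) where

  rung : ℕ → Edge W
  rung i = edge (2 ℕ.* i) (suc (2 ℕ.* i)) W ℕ.≤-refl 1≤W ℕ.≤-refl

  rung-lo-injective : ∀ i j → Edge.lo (rung i) ≡ Edge.lo (rung j) → i ≡ j
  rung-lo-injective i j = ℕ.*-cancelˡ-≡ i j 2

  -- Lower endpoints are even and upper ones odd, so two rungs could only meet at endpoints of the
  -- same kind, and either endpoint determines the index.
  rung-disjoint : ∀ {i j} → i ≢ j → VertexDisjoint (rung i) (rung j)
  rung-disjoint {i} {j} i≢j =
    i≢j ∘ rung-lo-injective i j , ℕ.even≢odd i j , ℕ.even≢odd j i ∘ ≡.sym ,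
    i≢j ∘ rung-lo-injective i j ∘ ℕ.suc-injective

  rungs : ℕ → List (Edge W)
  rungs = applyUpTo rung

  rung-endpoints : ∀ {i} → i ℕ.< k →
                   (2 ℕ.* i) ∈ upTo (2 ℕ.* k) × suc (2 ℕ.* i) ∈ upTo (2 ℕ.* k)
  rung-endpoints {i} i<k = ∈-upTo⁺ (ℕ.<-trans (ℕ.n<1+n _) hi<2k) , ∈-upTo⁺ hi<2k
    where
    hi<2k : suc (2 ℕ.* i) ℕ.< 2 ℕ.* k
    hi<2k = subst (ℕ._≤ 2 ℕ.* k) (ℕ.*-suc 2 i) (ℕ.*-monoʳ-≤ 2 i<k)

  -- The node set does not depend on `j`: all 2k nodes are present from the start, no step inserts a
  -- node, and the sequences differ in edges alone.
  ladder : ∀ j → j ℕ.≤ k → Graph W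
  ladder j j≤k = record
    { nodes     = upTo (2 ℕ.* k)
    ; edges     = rungs j
    ; endpoints = ends
    ; simple    = simple′
    }
    where
    ends : ∀ {e} → e ∈ rungs j → Edge.lo e ∈ upTo (2 ℕ.* k) × Edge.hi e ∈ upTo (2 ℕ.* k)
    ends e∈ with i , i<j , ≡.refl ← ∈-applyUpTo⁻ rung e∈ = rung-endpoints (ℕ.<-≤-trans i<j j≤k)

    simple′ : ∀ {e f} → e ∈ rungs j → f ∈ rungs j →
              Edge.lo e ≡ Edge.lo f → Edge.hi e ≡ Edge.hi f → e ≡ f
    simple′ e∈ f∈ lo≡ _
      with i , _ , ≡.refl ← ∈-applyUpTo⁻ rung e∈ | i′ , _ , ≡.refl ← ∈-applyUpTo⁻ rung f∈
      = cong rung (rung-lo-injective i i′ lo≡)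

  rungs-mono : ∀ {i j} → i ℕ.≤ j → ∀ {e} → e ∈ rungs i → e ∈ rungs j
  rungs-mono i≤j e∈ with _ , n<i , ≡.refl ← ∈-applyUpTo⁻ rung e∈ = ∈-applyUpTo⁺ rung (ℕ.<-≤-trans n<i i≤j)

  matchingWeight-uniform : ∀ {M : List (Edge W)} → All (λ e → Edge.weight e ≡ W) M →
                           matchingWeight M ≡ length M ℕ.* W
  matchingWeight-uniform []         = ≡.refl
  matchingWeight-uniform (≡.refl ∷ h) = cong (W ℕ.+_) (matchingWeight-uniform h)

  rungs-weight : ∀ {j e} → e ∈ rungs j → Edge.weight e ≡ W
  rungs-weight e∈ with _ , _ , ≡.refl ← ∈-applyUpTo⁻ rung e∈ = ≡.refl

  -- The rungs form a matching themselves. Every edge weighs `W`, so any other matching is bounded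
  -- through its length, and vertex-disjointness rules out repetitions.
  ladder-maximumMatchingWeight : ∀ j (j≤k : j ℕ.≤ k) →
                                 IsMaximumMatchingWeight (ladder j j≤k) (j ℕ.* W)
  ladder-maximumMatchingWeight j j≤k = (rungs j , (all , disjoint) , weight) , optimal
    where
    all : All (_∈ rungs j) (rungs j)
    all = All.applyUpTo⁺₁ rung j (∈-applyUpTo⁺ rung)

    disjoint = AllPairs.applyUpTo⁺₁ rung j λ i<i′ _ → rung-disjoint (ℕ.<⇒≢ i<i′)

    weight : matchingWeight (rungs j) ≡ j ℕ.* W
    weight = ≡.trans (matchingWeight-uniform (All.map (rungs-weight {j}) all))
                     (cong (ℕ._* W) (length-applyUpTo rung j))

    optimal : ∀ M → IsMatching (ladder j j≤k) M → matchingWeight M ℕ.≤ j ℕ.* W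
    optimal M (M⊆ , M-disjoint) = begin
      matchingWeight M         ≡⟨ matchingWeight-uniform (All.map (rungs-weight {j}) M⊆) ⟩
      length M ℕ.* W           ≤⟨ ℕ.*-monoˡ-≤ W (Unique⇒length≤ M-unique M⊆) ⟩
      length (rungs j) ℕ.* W   ≡⟨ cong (ℕ._* W) (length-applyUpTo rung j) ⟩
      j ℕ.* W                  ∎
      where
      open ℕ.≤-Reasoning
      M-unique : Unique M
      M-unique = AllPairs.map (λ { (lo≢lo , _) ≡.refl → lo≢lo ≡.refl }) M-disjoint

  module _ {T : ℕ} where
    open IncrementalSequence using (∂E⁺)

    grow : Profile k → IncrementalSequence W T
    grow c = record
      { G      = λ s → ladder (at c (toℕ s)) (bounded c (toℕ s))
      ; V-grow = λ _ → id
      ; E-grow = λ s → rungs-mono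
          (subst (λ n → at c n ℕ.≤ at c (suc (toℕ s))) (≡.sym (Fin.toℕ-inject₁ s)) (increasing c (toℕ s)))
      }

    cast : ∀ {m n e} → m ≡ n → e ∈ rungs m → e ∈ rungs n
    cast {e = e} = subst (λ n → e ∈ rungs n)

    module _ {t : Fin T} {j : ℕ} (c : Profile k) (isBurst : IsBurst (toℕ t) j c) where
      private
        before = proj₁ isBurst
        after  = proj₂ isBurst

      ∂E⁺-off-burst : ∀ s → s ≢ t → ∀ {e} → ¬ ∂E⁺ (grow c) s e
      ∂E⁺-off-burst s s≢t (e∈ , e∉) with Fin.<-cmp s t
      ... | tri≈ _ s≡t _ = s≢t s≡t
      -- Step `s` ends at time `suc s`, which is at most `t`, so there is still no edge.
      ... | tri< s<t _ _ with () ← cast (before s<t) e∈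
      -- Both ends of the step come after the burst and carry the same `j` rungs.
      ... | tri> _ _ t<s = e∉ (cast (≡.trans (after (ℕ.m<n⇒m<1+n t<s)) (≡.sym (after t<s′))) e∈)
        where t<s′ = subst (toℕ t ℕ.<_) (≡.sym (Fin.toℕ-inject₁ s)) t<s

      ∂E⁺-at-burst : ∂E⁺ (grow c) t ≐ (_∈ rungs j)
      ∂E⁺-at-burst =
        cast (after ℕ.≤-refl) ∘ proj₁ ,
        λ e∈ → cast (≡.sym (after ℕ.≤-refl)) e∈ , ∉[] ∘ cast (before t≤t)
        where
        t≤t = ℕ.≤-reflexive (Fin.toℕ-inject₁ t)
        ∉[] : ∀ {e : Edge W} → ¬ e ∈ []
        ∉[] ()

    -- Bursts at the same step insert nested initial segments of the rungs, so the one extra edge is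
    -- the last rung, `rung j`.
    burst-lacksOneEdge : ∀ {t : Fin T} {j} (c c′ : Profile k) →
      IsBurst (toℕ t) (suc j) c → IsBurst (toℕ t) j c′ → LacksOneEdge (grow c) (grow c′)
    burst-lacksOneEdge {t} {j} c c′ isBurst isBurst′ = record
      { same-initial = (id , id) ,
          cast (≡.trans (proj₁ isBurst z≤n) (≡.sym (proj₁ isBurst′ z≤n))) ,
          cast (≡.trans (proj₁ isBurst′ z≤n) (≡.sym (proj₁ isBurst z≤n)))
      ; same-∂V⁺     = λ _ → id , id
      ; e*           = rung j
      ; t*           = t
      ; same-∂E⁺     = λ s s≢t →
          (λ e∈ → contradiction e∈ (∂E⁺-off-burst c isBurst s s≢t)) ,
          (λ e∈ → contradiction e∈ (∂E⁺-off-burst c′ isBurst′ s s≢t))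
      ; ∂E⁺-⊆        = proj₂ new ∘ rungs-mono (ℕ.n≤1+n j) ∘ proj₁ new′
      ; ∂E⁺-∖        = (λ (e∈ , e∉) → missing (proj₁ new e∈) (e∉ ∘ proj₂ new′)) ,
          λ { ≡.refl → proj₂ new (∈-applyUpTo⁺ rung ℕ.≤-refl) , rung∉rungs ∘ proj₁ new′ }
      }
      where
      new  = ∂E⁺-at-burst c isBurst
      new′ = ∂E⁺-at-burst c′ isBurst′

      rung∉rungs : ¬ rung j ∈ rungs j
      rung∉rungs j∈ with i , i<j , eq ← ∈-applyUpTo⁻ rung j∈ =
        ℕ.<-irrefl (rung-lo-injective i j (cong Edge.lo (≡.sym eq))) i<j

      missing : ∀ {e} → e ∈ rungs (suc j) → ¬ e ∈ rungs j → rung j ≡ e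
      missing e∈ e∉ with i , i<1+j , ≡.refl ← ∈-applyUpTo⁻ rung e∈ =
        cong rung (≡.sym (ℕ.≤∧≮⇒≡ (ℕ.s≤s⁻¹ i<1+j) (e∉ ∘ ∈-applyUpTo⁺ rung)))

-- Packing

module Packing (em : ExcludedMiddle 0ℓ) (R : RealNumbers) {W T : ℕ} (1≤W : 1 ℕ.≤ W)
               (𝒜 : Privacy.Algorithm R W T) (k′ : ℕ) where
  open RealNumbers R
  open OrderedField em completeOrderedField
  open Privacy R
  open Algorithm 𝒜
  open Probability em R space
  module Events = SigmaAlgebra em event-isSigmaAlgebra
  open ≤-Reasoning

  private k = suc k′

  open DisjointEdges W 1≤W k

  -- The definition of an algorithm grants this for half-spaces only; the rest follows by induction
  -- on the construction of `S`.
  output∈-event : ∀ 𝒢 {S} → Borel S → IsEvent (λ ω → S (output 𝒢 ω))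
  output∈-event 𝒢 (half-space t r)             = measurable 𝒢 t r
  output∈-event 𝒢 (complement S-Borel)         = event-∁ (output∈-event 𝒢 S-Borel)
  output∈-event 𝒢 (union S S-Borel)            = event-⋃ _ (λ n → output∈-event 𝒢 (S-Borel n))
  output∈-event 𝒢 (resp (S⊆S′ , S′⊆S) S-Borel) =
    event-resp ((λ s → S⊆S′ s) , λ s → S′⊆S s) (output∈-event 𝒢 S-Borel)

  errorsAtMost-event : ∀ α 𝒢 → IsEvent (ErrorsAtMost 𝒜 α 𝒢)
  errorsAtMost-event α 𝒢 = Events.⋂Fin _ λ t → Events.⋂ℕ _ λ m →
    Events.⇒-measurable _ (∣-∣≤-measurable (measurable 𝒢 t) (fromℕ m) α)

  burstSequence : Fin T → ∀ j → j ℕ.≤ k → IncrementalSequence W T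
  burstSequence t j j≤k = grow (burst (toℕ t) j j≤k)

  module _ {ε : ℝ} {q : ℕ} (private-ε : EdgeDifferentiallyPrivate 𝒜 ε) (exp≤q : exp ε ≤ fromℕ q) where

    private-step : ∀ {𝒢 𝒢′ S} → LacksOneEdge 𝒢 𝒢′ → Borel S →
      Pr (λ ω → S (output 𝒢 ω)) ≤ fromℕ q * Pr (λ ω → S (output 𝒢′ ω))
    private-step {𝒢} {𝒢′} {S} lacks S-Borel = ≤-trans
      (private-ε 𝒢 𝒢′ (inj₁ lacks) S S-Borel)
      (*-monoˡ-≤ (Pr-nonNeg (output∈-event 𝒢′ S-Borel)) exp≤q)

    -- The edges of the burst are removed one at a time, each at the cost of a factor `q`. The
    -- natural number `q` bounds e^ε, so the total factor is a power of a natural. The induction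
    -- starts from one edge, whose removal leads to `grow quiet`, the same input for every `t`.
    group-privacy : ∀ t {S} → Borel S → ∀ j (1+j≤k : suc j ℕ.≤ k) →
      Pr (λ ω → S (output (burstSequence t (suc j) 1+j≤k) ω)) ≤
      fromℕ (q ℕ.^ suc j) * Pr (λ ω → S (output (grow quiet) ω))
    group-privacy t {S} S-Borel zero 1≤k = begin
      Pr (λ ω → S (output (burstSequence t 1 1≤k) ω))
        ≤⟨ private-step (burst-lacksOneEdge (burst (toℕ t) 1 1≤k) quiet (burst-isBurst (toℕ t) 1≤k)
             ((λ _ → ≡.refl) , (λ _ → ≡.refl))) S-Borel ⟩
      fromℕ q * Pr (λ ω → S (output (grow quiet) ω))
        ≡⟨ cong (λ n → fromℕ n * Pr (λ ω → S (output (grow quiet) ω))) (ℕ.^-identityʳ q) ⟨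
      fromℕ (q ℕ.^ 1) * Pr (λ ω → S (output (grow quiet) ω)) ∎
    group-privacy t {S} S-Borel (suc j) 2+j≤k = begin
      Pr (λ ω → S (output (burstSequence t (2 ℕ.+ j) 2+j≤k) ω))
        ≤⟨ private-step (burst-lacksOneEdge (burst (toℕ t) _ 2+j≤k) (burst (toℕ t) _ (ℕ.<⇒≤ 2+j≤k))
             (burst-isBurst (toℕ t) 2+j≤k) (burst-isBurst (toℕ t) (ℕ.<⇒≤ 2+j≤k))) S-Borel ⟩
      fromℕ q * Pr (λ ω → S (output (burstSequence t (suc j) (ℕ.<⇒≤ 2+j≤k)) ω))
        ≤⟨ *-monoʳ-≤ (0≤fromℕ q) (group-privacy t S-Borel j (ℕ.<⇒≤ 2+j≤k)) ⟩
      fromℕ q * (fromℕ (q ℕ.^ suc j) * p₀)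
        ≈⟨ *-assoc _ _ p₀ ⟨
      fromℕ q * fromℕ (q ℕ.^ suc j) * p₀
        ≈⟨ *-congʳ (fromℕ-homo-* q (q ℕ.^ suc j)) ⟨
      fromℕ (q ℕ.^ (2 ℕ.+ j)) * p₀ ∎
      where p₀ = Pr (λ ω → S (output (grow quiet) ω))

    module _ {α β : ℝ} (accurate : HasAdditiveError 𝒜 α β)
             (2α<kW : α + α < fromℕ (k ℕ.* W)) where

      -- Disjoint for distinct t, since t is the first time the output exceeds α.
      Detects : Fin T → Pred (Fin T → ℝ) 0ℓ
      Detects t y = (∀ s → s Fin.< t → y s ≤ α) × ¬ y t ≤ α

      Detects-Borel : ∀ t → Borel (Detects t)
      Detects-Borel t = ∩-measurable
        (⋂Fin _ λ s → ⇒-measurable _ (half-space s α))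
        (complement (half-space t α))
        where open SigmaAlgebra em (Borel-isSigmaAlgebra em R t)

      Detects-disjoint : ∀ s t → s ≢ t → Detects s ⊥ Detects t
      Detects-disjoint s t s≢t ((before-s , y-s) , (before-t , y-t)) with Fin.<-cmp s t
      ... | tri< s<t _ _ = y-s (before-t s s<t)
      ... | tri≈ _ s≡t _ = s≢t s≡t
      ... | tri> _ _ t<s = y-t (before-s t t<s)

      -- The true value is 0 before step `t` and kW right after it. Hence earlier outputs are at
      -- most α, while the output at `t` is at least kW - α, which exceeds α.
      accurate⇒detects : ∀ t {ω} → ErrorsAtMost 𝒜 α (burstSequence t k ℕ.≤-refl) ω →
                         Detects t (output (burstSequence t k ℕ.≤-refl) ω)
      accurate⇒detects t {ω} errors = undetected , detected
        where
        y = output (burstSequence t k ℕ.≤-refl) ω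

        -- The output at step `s` estimates the graph at time `suc s`; thus `s < t` falls before the
        -- burst and `s = t` already after it.
        error : ∀ s {j} → Profile.at (burst (toℕ t) k ℕ.≤-refl) (suc (toℕ s)) ≡ j →
                ∣ y s - fromℕ (j ℕ.* W) ∣ ≤ α
        error s ≡.refl = errors s _
          (ladder-maximumMatchingWeight _ (Profile.bounded (burst (toℕ t) k ℕ.≤-refl) (suc (toℕ s))))

        undetected : ∀ s → s Fin.< t → y s ≤ α
        undetected s s<t = begin
          y s    ≤⟨ ∣x-y∣≤z⇒x≤z+y (error s (proj₁ (burst-isBurst (toℕ t) ℕ.≤-refl) s<t)) ⟩
          α + 0# ≈⟨ +-identityʳ α ⟩
          α      ∎

        detected : ¬ y t ≤ α
        detected yt≤α = <⇒≰ 2α<kW (begin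
          fromℕ (k ℕ.* W) ≤⟨ ∣x-y∣≤z⇒y≤z+x (error t (proj₂ (burst-isBurst (toℕ t) ℕ.≤-refl) ℕ.≤-refl)) ⟩
          α + y t         ≤⟨ +-monoʳ-≤ α yt≤α ⟩
          α + α           ∎)

      packing : fromℕ T * (1# - β) ≤ fromℕ (q ℕ.^ k)
      packing = disjoint-packing
        -- All events refer to the output on the one empty input, where they are disjoint; the burst
        -- inputs enter only through the lower bounds on their probabilities.
        (λ t ω → Detects t (output (grow quiet) ω))
        (λ t → output∈-event (grow quiet) (Detects-Borel t))
        (λ s t s≢t → Detects-disjoint s t s≢t)
        (0≤fromℕ (q ℕ.^ k))
        λ t → let 𝒢ₜ = burstSequence t k ℕ.≤-refl in begin
          1# - β                                 ≤⟨ accurate 𝒢ₜ ⟩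
          Pr (ErrorsAtMost 𝒜 α 𝒢ₜ)               ≤⟨ Pr-mono-≤ (errorsAtMost-event α 𝒢ₜ)
                                                      (output∈-event 𝒢ₜ (Detects-Borel t)) (accurate⇒detects t) ⟩
          Pr (λ ω → Detects t (output 𝒢ₜ ω))     ≤⟨ group-privacy t (Detects-Borel t) k′ ℕ.≤-refl ⟩
          fromℕ (q ℕ.^ k) * Pr (λ ω → Detects t (output (grow quiet) ω)) ∎

-- Powers of two, rounded logarithms and integer division.

n≤2^n : ∀ n → n ℕ.≤ 2 ℕ.^ n
n≤2^n zero    = z≤n
n≤2^n (suc n) = ℕ.+-mono-≤ (ℕ.m^n>0 2 n) (ℕ.≤-trans (n≤2^n n) (ℕ.m≤m+n _ 0))

2^n≤T⇒n≤⌈log₂T⌉ : ∀ {n T} → 2 ℕ.^ n ℕ.≤ T → n ℕ.≤ ⌈log₂ T ⌉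
2^n≤T⇒n≤⌈log₂T⌉ {n} h = subst (ℕ._≤ _) (⌈log₂2^n⌉≡n n) (⌈log₂⌉-mono-≤ h)

T≤2^n⇒⌈log₂T⌉≤n : ∀ {n T} → T ℕ.≤ 2 ℕ.^ n → ⌈log₂ T ⌉ ℕ.≤ n
T≤2^n⇒⌈log₂T⌉≤n {n} h = subst (_ ℕ.≤_) (⌈log₂2^n⌉≡n n) (⌈log₂⌉-mono-≤ h)

-- Take `k` to be (L - m)/b rounded down. It is positive because b + m ≤ L; hence the remainder is
-- at most kb and m at most km, which gives the upper bound on `L`.
proportional-quotient : ∀ b m L .{{_ : ℕ.NonZero b}} → b ℕ.+ m ℕ.≤ L →
  Σ ℕ λ k → 1 ℕ.≤ k × k ℕ.* b ℕ.+ m ℕ.≤ L × L ℕ.≤ k ℕ.* (b ℕ.+ b ℕ.+ m)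
proportional-quotient b m L b+m≤L = k , 1≤k , lower , upper
  where
  open ℕ.≤-Reasoning
  N = L ℕ.∸ m
  k = N ℕ./ b

  N+m≡L : N ℕ.+ m ≡ L
  N+m≡L = ℕ.m∸n+n≡m (ℕ.m+n≤o⇒n≤o b b+m≤L)

  1≤k : 1 ℕ.≤ k
  1≤k = m≥n⇒m/n>0 (ℕ.m+n≤o⇒m≤o∸n b b+m≤L)

  n≤k*n : ∀ n → n ℕ.≤ k ℕ.* n
  n≤k*n n = ℕ.m≤n*m n k {{ℕ.>-nonZero 1≤k}}

  lower : k ℕ.* b ℕ.+ m ℕ.≤ L
  lower = begin
    k ℕ.* b ℕ.+ m ≤⟨ ℕ.+-monoˡ-≤ m (m/n*n≤m N b) ⟩
    N ℕ.+ m       ≡⟨ N+m≡L ⟩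
    L             ∎

  upper : L ℕ.≤ k ℕ.* (b ℕ.+ b ℕ.+ m)
  upper = begin
    L                                       ≡⟨ N+m≡L ⟨
    N ℕ.+ m                                 ≡⟨ cong (ℕ._+ m) (m≡m%n+[m/n]*n N b) ⟩
    N ℕ.% b ℕ.+ k ℕ.* b ℕ.+ m               ≤⟨ ℕ.+-mono-≤ (ℕ.+-monoˡ-≤ (k ℕ.* b)
                                                (ℕ.≤-trans (m%n≤n N b) (n≤k*n b))) (n≤k*n m) ⟩
    k ℕ.* b ℕ.+ k ℕ.* b ℕ.+ k ℕ.* m         ≡⟨ cong (ℕ._+ k ℕ.* m) (ℕ.*-distribˡ-+ k b b) ⟨
    k ℕ.* (b ℕ.+ b) ℕ.+ k ℕ.* m             ≡⟨ ℕ.*-distribˡ-+ k (b ℕ.+ b) m ⟨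
    k ℕ.* (b ℕ.+ b ℕ.+ m)                   ∎

-- Choice of the constants and the lower bound.

module LowerBound (em : ExcludedMiddle 0ℓ) (R : RealNumbers) where
  open RealNumbers R
  open Privacy R
  open OrderedField em completeOrderedField
  open Exponential em R

  module Constants (ε₀ β : ℝ) (b′ d : ℕ) (exp≤2^b : exp ε₀ ≤ fromℕ (2 ℕ.^ suc b′))
                   (1≤2^dγ : 1# ≤ fromℕ (2 ℕ.^ d) * (1# - β)) where

    -- With L = ⌈log₂ T⌉ and k = ⌊(L − d − 1)/b⌋, one has 2^d q^k < T, so that
    -- α ≥ kW/2, and L ≤ k K.
    b K q : ℕ
    b = suc b′
    K = b ℕ.+ b ℕ.+ suc d
    q = 2 ℕ.^ b

    -- From α ≥ kW/2 and L ≤ kK follows α ≥ WL/(2K), whence c = 1/(2K).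
    γ c : ℝ
    γ = 1# - β
    c = fromℕ (K ℕ.+ K) ⁻¹

    0<2K : 0# < fromℕ (K ℕ.+ K)
    0<2K = 0<fromℕ-suc (b′ ℕ.+ b ℕ.+ suc d ℕ.+ K)

    -- The factor 2^d absorbs the success probability: T ≤ 2^d T γ ≤ 2^d q^k = 2^(d + bk).
    packed⇒⌈log₂T⌉≤ : ∀ {T} k → fromℕ T * γ ≤ fromℕ (q ℕ.^ k) → ⌈log₂ T ⌉ ℕ.≤ d ℕ.+ b ℕ.* k
    packed⇒⌈log₂T⌉≤ {T} k packed = T≤2^n⇒⌈log₂T⌉≤n {T = T} (fromℕ-cancel-≤ (begin
      fromℕ T                               ≈⟨ *-identityʳ _ ⟨
      fromℕ T * 1#                          ≤⟨ *-monoʳ-≤ (0≤fromℕ T) 1≤2^dγ ⟩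
      fromℕ T * (fromℕ (2 ℕ.^ d) * γ)       ≈⟨ *-assoc _ _ γ ⟨
      fromℕ T * fromℕ (2 ℕ.^ d) * γ         ≈⟨ *-congʳ (*-comm _ _) ⟩
      fromℕ (2 ℕ.^ d) * fromℕ T * γ         ≈⟨ *-assoc _ _ γ ⟩
      fromℕ (2 ℕ.^ d) * (fromℕ T * γ)       ≤⟨ *-monoʳ-≤ (0≤fromℕ (2 ℕ.^ d)) packed ⟩
      fromℕ (2 ℕ.^ d) * fromℕ (q ℕ.^ k)     ≈⟨ fromℕ-homo-* (2 ℕ.^ d) (q ℕ.^ k) ⟨
      fromℕ (2 ℕ.^ d ℕ.* q ℕ.^ k)           ≡⟨ cong (λ n → fromℕ (2 ℕ.^ d ℕ.* n)) (ℕ.^-*-assoc 2 b k) ⟩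
      fromℕ (2 ℕ.^ d ℕ.* 2 ℕ.^ (b ℕ.* k))   ≡⟨ cong fromℕ (ℕ.^-distribˡ-+-* 2 d (b ℕ.* k)) ⟨
      fromℕ (2 ℕ.^ (d ℕ.+ b ℕ.* k))         ∎))
      where open ≤-Reasoning

    bound : (ε : ℝ) → 0# < ε → ε ≤ ε₀ →
            (W T : ℕ) → 1 ℕ.≤ W → 2 ℕ.^ (b ℕ.+ suc d) ℕ.≤ T →
            (𝒜 : Algorithm W T) → EdgeDifferentiallyPrivate 𝒜 ε →
            (α : ℝ) → HasAdditiveError 𝒜 α β →
            c * fromℕ W * fromℕ ⌈log₂ T ⌉ ≤ α
    bound ε 0<ε ε≤ε₀ W T 1≤W T₀≤T 𝒜 private-ε α accurate
      with proportional-quotient b (suc d) ⌈log₂ T ⌉ (2^n≤T⇒n≤⌈log₂T⌉ T₀≤T)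
    -- The quotient is at least 1, so `k` is a successor, as `Packing` requires.
    ... | k@(suc k′) , _ , kb+d<L , L≤kK = begin
      c * fromℕ W * fromℕ L               ≈⟨ *-assoc c _ _ ⟩
      c * (fromℕ W * fromℕ L)             ≈⟨ *-congˡ (fromℕ-homo-* W L) ⟨
      c * fromℕ (W ℕ.* L)                 ≤⟨ *-monoʳ-≤ 0≤c (fromℕ-mono-≤ WL≤KkW) ⟩
      c * fromℕ (K ℕ.* (k ℕ.* W))         ≈⟨ *-congˡ (fromℕ-homo-* K (k ℕ.* W)) ⟩
      c * (fromℕ K * fromℕ (k ℕ.* W))     ≤⟨ *-monoʳ-≤ 0≤c (*-monoʳ-≤ (0≤fromℕ K) kW≤2α) ⟩
      c * (fromℕ K * (α + α))             ≈⟨ *-congˡ (distribˡ (fromℕ K) α α) ⟩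
      c * (fromℕ K * α + fromℕ K * α)     ≈⟨ *-congˡ (distribʳ α (fromℕ K) (fromℕ K)) ⟨
      c * ((fromℕ K + fromℕ K) * α)       ≈⟨ *-congˡ (*-congʳ (fromℕ-homo-+ K K)) ⟨
      c * (fromℕ (K ℕ.+ K) * α)           ≈⟨ *-assoc c _ α ⟨
      c * fromℕ (K ℕ.+ K) * α             ≈⟨ *-congʳ (trans (*-comm c _) (*-inverseʳ (<⇒≉0 0<2K))) ⟩
      1# * α                              ≈⟨ *-identityˡ α ⟩
      α                                   ∎
      where
      open ≤-Reasoning
      L = ⌈log₂ T ⌉
      0≤c = proj₁ (0<x⇒0<x⁻¹ 0<2K)

      WL≤KkW : W ℕ.* L ℕ.≤ K ℕ.* (k ℕ.* W)
      WL≤KkW = subst (W ℕ.* L ℕ.≤_)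
        (≡.trans (ℕ.*-comm W (k ℕ.* K)) (≡.trans (cong (ℕ._* W) (ℕ.*-comm k K)) (ℕ.*-assoc K k W)))
        (ℕ.*-monoʳ-≤ W L≤kK)

      kW≤2α : fromℕ (k ℕ.* W) ≤ α + α
      -- If 2α < kW, packing yields L ≤ d + bk, whereas `k` was chosen with d + 1 + bk ≤ L.
      kW≤2α = decidable-stable em λ kW≰2α → ℕ.<⇒≱ kb+d<L′
        (packed⇒⌈log₂T⌉≤ {T} k (packing {q = q} private-ε
          (≤-trans (exp-mono-≤ (proj₁ 0<ε) ε≤ε₀) exp≤2^b) accurate (≰⇒> kW≰2α)))
        where
        open Packing em R 1≤W 𝒜 k′
        kb+d<L′ : d ℕ.+ b ℕ.* k ℕ.< L
        kb+d<L′ = subst (ℕ._≤ L)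
          (≡.trans (ℕ.+-comm (k ℕ.* b) (suc d)) (cong (λ n → suc (d ℕ.+ n)) (ℕ.*-comm k b))) kb+d<L

-- The constants `c` and `T₀` depend on ε₀ and β only and are fixed before ε, W, T and the
-- algorithm, as Ω(W log T) demands. Choosing ε₀ = 1 covers ε = 1.
theorem37 : Classical →
    (R : RealNumbers) →
    let open RealNumbers R
        open Privacy R
    in
    (ε₀ β : ℝ) → 0# < ε₀ → 0# < β → β < 1# →
    Σ ℝ λ c → 0# < c ×
    Σ ℕ λ T₀ →
      (ε : ℝ) → 0# < ε → ε ≤ ε₀ →
      (W T : ℕ) → 1 ℕ.≤ W → T₀ ℕ.≤ T →
      (𝒜 : Algorithm W T) → EdgeDifferentiallyPrivate 𝒜 ε →
      (α : ℝ) → HasAdditiveError 𝒜 α β →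
      c * fromℕ W * fromℕ ⌈log₂ T ⌉ ≤ α
-- This threshold makes the logarithm at least b + d + 1, so that at least one edge can be inserted.
theorem37 classical R ε₀ β _ _ β<1 = c , 0<x⇒0<x⁻¹ 0<2K , 2 ℕ.^ (b ℕ.+ suc d) , bound
  where
  open RealNumbers R
  em : ExcludedMiddle 0ℓ
  em = classical
  open OrderedField em completeOrderedField

  fromℕ≤2^ : ∀ n → fromℕ n ≤ fromℕ (2 ℕ.^ n)
  fromℕ≤2^ n = fromℕ-mono-≤ (n≤2^n n)

  -- The exponent is a successor because `b` later serves as a divisor.
  ∃b′ : Σ ℕ λ b′ → exp ε₀ ≤ fromℕ (2 ℕ.^ suc b′)
  ∃b′ with b′ , h ← archimedean (exp ε₀) = b′ ,
    ≤-trans h (≤-trans (fromℕ-mono-≤ (ℕ.n≤1+n b′)) (fromℕ≤2^ (suc b′)))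

  ∃d : Σ ℕ λ d → 1# ≤ fromℕ (2 ℕ.^ d) * (1# - β)
  ∃d with d , h ← inverse-archimedean (x<y⇒0<y-x β<1) = d ,
    ≤-trans h (*-monoˡ-≤ (proj₁ (x<y⇒0<y-x β<1)) (fromℕ≤2^ d))

  d : ℕ
  d = proj₁ ∃d

  open LowerBound.Constants em R ε₀ β (proj₁ ∃b′) d (proj₂ ∃b′) (proj₂ ∃d)
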